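{- Every univalent updown category $\mathcal C$ has a universal cover $\tilde{\mathcal C}$; that is, there exist a univalent updown category $\tilde{\mathcal C}$ and a universal covering map $\pi:\tilde{\mathcal C}\to\mathcal C$.
   Context: An updown category is a small category $\mathcal C$ with a rank functor $|\cdot|:\mathcal C\to\mathbb N$ (where $\mathbb N=\{0,1,2,\dots\}$ is the ordered set of natural numbers regarded as a category) such that: (A1) each rank $\mathcal C_n=\{p\in\operatorname{Ob}\mathcal C:|p|=n\}$ is finite; (A2) $\mathcal C_0$ consists of a single object $\hat 0$, and $\operatorname{Hom}(\hat 0,p)$ is nonempty for all objects $p$; (A3) for objects $p,p'$, $\operatorname{Hom}(p,p')$ is always finite, and $\operatorname{Hom}(p,p')=\emptyset$ unless $|p|<|p'|$ or $p=p'$; in the latter case $\operatorname{Hom}(p,p)$ is a group, denoted $\operatorname{Aut}(p)$; (A4) any morphism $p\to p'$ with $|p'|=|p|+k$ factors as a composition $p=p_0\to p_1\to\cdots\to p_k=p'$ with $|p_{i+1}|=|p_i|+1$; (A5) if $|p'|=|p|+1$, the actions of $\operatorname{Aut}(p)$ and $\operatorname{Aut}(p')$ on $\operatorname{Hom}(p,p')$ (by precomposition and postcomposition respectively) are free. $\mathcal C$ is univalent if $\operatorname{Aut}(p)$ is trivial for all $p\in\operatorname{Ob}\mathcal C$. A morphism $F:\mathcal C\to\mathcal D$ of univalent updown categories is a rank-preserving functor such that for all $p,q\in\operatorname{Ob}\mathcal C$ with $|q|=|p|+1$ the induced function $\coprod_{\{q':F(q')=F(q)\}}\operatorname{Hom}(p,q')\to\operatorname{Hom}(F(p),F(q))$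 is injective. A morphism $\pi:\mathcal C'\to\mathcal C$ of univalent updown categories is a covering map if $\pi$ is surjective on the object sets and the induced function $\coprod_{\{q':\pi(q')=\pi(q)\}}\operatorname{Hom}(p,q')\to\operatorname{Hom}(\pi(p),\pi(q))$ is a bijection for all $p,q\in\operatorname{Ob}\mathcal C'$ with $|q|=|p|+1$. A covering map $\pi:\tilde{\mathcal C}\to\mathcal C$ is universal if for any other covering map $\phi:\mathcal C'\to\mathcal C$ there is a covering map $\psi:\tilde{\mathcal C}\to\mathcal C'$ with $\pi=\phi\psi$; then $\tilde{\mathcal C}$ is called a universal cover of $\mathcal C$. -}

module Defs where

open import Level using (Level; 0ℓ; _⊔_) renaming (suc to lsuc)
open import Algebra.Core using (Op₁)
open import Algebra.Structures using (IsGroup)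
open import Data.Fin.Base using (Fin)
open import Data.Nat.Base as ℕ using (ℕ; _+_; _≤_; _<_)
open import Data.Nat.Properties using (≤-refl; ≤-trans; ≤-irrelevant)
open import Data.Product.Base using (Σ; ∃; _×_; _,_)
open import Data.Sum.Base using (_⊎_)
open import Function.Bundles using (_↔_)
open import Function.Definitions using (Injective; Surjective; Bijective)
open import Relation.Binary.PropositionalEquality using (_≡_; cong; subst; subst₂; trans)

private
  variable
    a o h o′ h′ o″ h″ ℓ : Level

Finite : Set a → Set a
Finite A = ∃ λ n → A ↔ Fin n

-- Objects and morphisms are compared with _≡_, since the theory below
-- uses equality of objects (p = p′, F(q′) = F(q)) throughout.

record Category (o h : Level) : Set (lsuc (o ⊔ h)) where
  infixr 9 _∘_
  field
    Ob        : Set o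
    Hom       : Ob → Ob → Set h
    id        : ∀ {p} → Hom p p
    _∘_       : ∀ {p q r} → Hom q r → Hom p q → Hom p r
    identityˡ : ∀ {p q} (f : Hom p q) → id ∘ f ≡ f
    identityʳ : ∀ {p q} (f : Hom p q) → f ∘ id ≡ f
    assoc     : ∀ {p q r s} (f : Hom r s) (g : Hom q r) (k : Hom p q) →
                (f ∘ g) ∘ k ≡ f ∘ (g ∘ k)

record Functor (C : Category o h) (D : Category o′ h′) :
               Set (o ⊔ h ⊔ o′ ⊔ h′) where
  private
    module C = Category C
    module D = Category D
  field
    F₀           : C.Ob → D.Ob
    F₁           : ∀ {p q} → C.Hom p q → D.Hom (F₀ p) (F₀ q)
    identity     : ∀ {p} → F₁ (C.id {p}) ≡ D.id
    homomorphism : ∀ {p q r} (f : C.Hom q r) (g : C.Hom p q) →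
                   F₁ (f C.∘ g) ≡ F₁ f D.∘ F₁ g

infixr 9 _∘F_
infix  4 _≡F_

_∘F_ : {C : Category o h} {D : Category o′ h′} {E : Category o″ h″} →
       Functor D E → Functor C D → Functor C E
G ∘F F = record
  { F₀           = λ p → G.F₀ (F.F₀ p)
  ; F₁           = λ f → G.F₁ (F.F₁ f)
  ; identity     = trans (cong G.F₁ F.identity) G.identity
  ; homomorphism = λ f g → trans (cong G.F₁ (F.homomorphism f g))
                                 (G.homomorphism (F.F₁ f) (F.F₁ g))
  }
  where
    module G = Functor G
    module F = Functor F

-- Strict equality of functors (not natural isomorphism), stated pointwise
-- because function extensionality is not available.

_≡F_ : {C : Category o h} {D : Category o′ h′} →
       Functor C D → Functor C D → Set (o ⊔ h ⊔ o′ ⊔ h′)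
_≡F_ {C = C} {D = D} F G =
  Σ (∀ p → F.F₀ p ≡ G.F₀ p) λ eq →
    ∀ {p q} (f : C.Hom p q) → subst₂ D.Hom (eq p) (eq q) (F.F₁ f) ≡ G.F₁ f
  where
    module C = Category C
    module D = Category D
    module F = Functor F
    module G = Functor G

ℕ-category : Category 0ℓ 0ℓ
ℕ-category = record
  { Ob        = ℕ
  ; Hom       = _≤_
  ; id        = ≤-refl
  ; _∘_       = λ n≤k m≤n → ≤-trans m≤n n≤k
  ; identityˡ = λ _ → ≤-irrelevant _ _
  ; identityʳ = λ _ → ≤-irrelevant _ _
  ; assoc     = λ _ _ _ → ≤-irrelevant _ _
  }

module _ (C : Category o h) (rank : Functor C ℕ-category) where
  open Category C
  open Functor rank using () renaming (F₀ to ∣_∣)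

  -- Chain k p p′ : sequences p = p₀ → p₁ → ⋯ → p_k = p′ of morphisms, each
  -- raising the rank by exactly one.
  data Chain : ℕ → Ob → Ob → Set (o ⊔ h) where
    []  : ∀ {p} → Chain 0 p p
    _∷_ : ∀ {k p q r} → (Hom p q × ∣ q ∣ ≡ ∣ p ∣ + 1) →
          Chain k q r → Chain (ℕ.suc k) p r

  composite : ∀ {k p p′} → Chain k p p′ → Hom p p′
  composite []            = id
  composite ((f , _) ∷ c) = composite c ∘ f

record UpdownCategory (ℓ : Level) : Set (lsuc ℓ) where
  field
    category : Category ℓ ℓ
    rank     : Functor category ℕ-category

  open Category category public
  open Functor rank public using () renaming (F₀ to ∣_∣)

  field
    rank-finite : ∀ n → Finite (∃ λ p → ∣ p ∣ ≡ n)

    0̂           : Ob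
    ∣0̂∣≡0       : ∣ 0̂ ∣ ≡ 0
    0̂-unique    : ∀ p → ∣ p ∣ ≡ 0 → p ≡ 0̂
    0̂-hom       : ∀ p → Hom 0̂ p

    hom-finite  : ∀ p p′ → Finite (Hom p p′)
    hom-rank    : ∀ {p p′} → Hom p p′ → ∣ p ∣ < ∣ p′ ∣ ⊎ p ≡ p′
    aut-group   : ∀ p → Σ (Op₁ (Hom p p)) λ _⁻¹ →
                  IsGroup _≡_ (_∘_ {p} {p} {p}) id _⁻¹

    -- The bound k ≥ 1 is needed: for k = 0 the empty composition is the
    -- identity, and a nontrivial automorphism would have no factorization.
    factor      : ∀ {p p′} k → 1 ≤ k → ∣ p′ ∣ ≡ ∣ p ∣ + k → (f : Hom p p′) →
                  ∃ λ (c : Chain category rank k p p′) →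
                    composite category rank c ≡ f

    freeʳ       : ∀ {p p′} → ∣ p′ ∣ ≡ ∣ p ∣ + 1 →
                  (f : Hom p p′) (α : Hom p p) → f ∘ α ≡ f → α ≡ id
    freeˡ       : ∀ {p p′} → ∣ p′ ∣ ≡ ∣ p ∣ + 1 →
                  (f : Hom p p′) (β : Hom p′ p′) → β ∘ f ≡ f → β ≡ id

record UnivalentUpdownCategory (ℓ : Level) : Set (lsuc ℓ) where
  field
    updownCategory : UpdownCategory ℓ

  open UpdownCategory updownCategory public

  field
    aut-trivial : ∀ {p} (α : Hom p p) → α ≡ id

module _ (C D : UnivalentUpdownCategory ℓ) where
  private
    module C = UnivalentUpdownCategory C
    module D = UnivalentUpdownCategory D

  module _ (F : Functor C.category D.category) where
    open Functor F

    -- ∐ Hom(p , q′) over all objects q′ with F(q′) = F(q).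
    FibreHom : C.Ob → C.Ob → Set ℓ
    FibreHom p q = Σ (∃ λ q′ → F₀ q′ ≡ F₀ q) λ (q′ , _) → C.Hom p q′

    induced : ∀ p q → FibreHom p q → D.Hom (F₀ p) (F₀ q)
    induced p q ((q′ , eq) , f) = subst (D.Hom (F₀ p)) eq (F₁ f)

  record Morphism : Set ℓ where
    field
      functor           : Functor C.category D.category

    open Functor functor public

    field
      rank-preserving   : ∀ p → D.∣ F₀ p ∣ ≡ C.∣ p ∣
      induced-injective : ∀ p q → C.∣ q ∣ ≡ C.∣ p ∣ + 1 →
                          Injective _≡_ _≡_ (induced functor p q)

  record CoveringMap : Set ℓ where
    field
      morphism          : Morphism

    open Morphism morphism public

    field
      surjective        : Surjective _≡_ _≡_ F₀
      induced-bijective : ∀ p q → C.∣ q ∣ ≡ C.∣ p ∣ + 1 →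
                          Bijective _≡_ _≡_ (induced functor p q)

IsUniversal : {C̃ C : UnivalentUpdownCategory ℓ} → CoveringMap C̃ C → Set (lsuc ℓ)
IsUniversal {ℓ} {C̃} {C} π =
  (C′ : UnivalentUpdownCategory ℓ) (φ : CoveringMap C′ C) →
  ∃ λ (ψ : CoveringMap C̃ C′) →
    CoveringMap.functor π ≡F CoveringMap.functor φ ∘F CoveringMap.functor ψ

{-# OPTIONS --safe #-}

-- A rank-preserving functor is a covering map exactly when it is bijective on
-- stars, the star of p being the set of all morphisms out of p that raise the
-- rank by one; surjectivity on objects then follows from (A4).  The universal
-- cover is the tree of paths 0̂ → p₁ → ⋯ → p_n of such morphisms, ordered by
-- extension, and π sends a path to its endpoint.  Along a covering map φ a path
-- is lifted one edge at a time, which gives a functor ψ with π = φψ, and ψ is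
-- bijective on stars because π and φ are.
module Submission where

open import Defs
open import Level using (Level)
open import Axiom.UniquenessOfIdentityProofs.WithK using (uip)
open import Data.Empty using (⊥-elim)
open import Data.Fin.Base using (Fin; zero; suc)
open import Data.Fin.Properties using (+↔⊎) renaming (_≟_ to _≟ᶠ_)
open import Data.Nat.Base using (ℕ; zero; suc; _+_; _≤_; _<_; z≤n; s≤s)
open import Data.Nat.Properties
  using (+-comm; +-suc; +-identityʳ; +-cancelʳ-≡; ≤-refl; ≤-trans; ≤-reflexive;
         <-irrefl; <⇒≤; m≤m+n; 1+n≢0; suc-injective; _≟_)
open import Data.Product.Base using (Σ; ∃; _×_; _,_; proj₁; proj₂)
open import Data.Product.Function.Dependent.Propositional using (Σ-↔)
open import Data.Sum.Base using (_⊎_; inj₁; inj₂)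
open import Data.Sum.Function.Propositional using (_⊎-↔_)
open import Function.Base using (_∘′_)
open import Function.Bundles using (_↔_; mk↔ₛ′; module Inverse)
open import Function.Construct.Composition using (_↔-∘_)
open import Function.Construct.Identity using (↔-id)
open import Function.Construct.Symmetry using (↔-sym)
open import Function.Definitions using (Injective; Surjective)
open import Relation.Binary.Definitions using (DecidableEquality)
open import Relation.Binary.PropositionalEquality
  using (_≡_; refl; sym; trans; cong; cong₂; subst; subst₂; isEquivalence)
open import Relation.Nullary using (Dec; yes; no; Irrelevant)
open import Relation.Nullary.Decidable using (map′)

private
  variable
    a b ℓ : Level

-- Finite types

finite-↔ : {A : Set a} {B : Set b} → A ↔ B → Finite B → Finite A
finite-↔ A↔B (n , B↔n) = n , B↔n ↔-∘ A↔B

finite-dec-prop : {A : Set a} → Irrelevant A → Dec A → Finite A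
finite-dec-prop irr (yes x) =
  1 , mk↔ₛ′ (λ _ → zero) (λ _ → x) (λ { zero → refl }) (irr x)
finite-dec-prop irr (no ¬x) =
  0 , mk↔ₛ′ (λ x → ⊥-elim (¬x x)) (λ ()) (λ ()) (λ x → ⊥-elim (¬x x))

finite-≟ : {A : Set a} → Finite A → DecidableEquality A
finite-≟ (n , A↔n) x y =
  map′ (λ eq → trans (sym (strictlyInverseʳ x))
                     (trans (cong from eq) (strictlyInverseʳ y)))
       (cong to) (to x ≟ᶠ to y)
  where open Inverse A↔n

finite-Σ-Fin : ∀ n {B : Fin n → Set b} → (∀ i → Finite (B i)) →
               Finite (Σ (Fin n) B)
finite-Σ-Fin zero    fin = 0 , mk↔ₛ′ (λ ()) (λ ()) (λ ()) (λ ())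
finite-Σ-Fin (suc n) {B} fin =
  let k , B₀↔k = fin zero
      m , Σ↔m  = finite-Σ-Fin n (λ i → fin (suc i))
  in k + m , ↔-sym (+↔⊎ {k}) ↔-∘ ((B₀↔k ⊎-↔ Σ↔m) ↔-∘ split)
  where
  split : Σ (Fin (suc n)) B ↔ (B zero ⊎ Σ (Fin n) (B ∘′ suc))
  split = mk↔ₛ′
    (λ { (zero , x) → inj₁ x ; (suc i , x) → inj₂ (i , x) })
    (λ { (inj₁ x) → zero , x ; (inj₂ (i , x)) → suc i , x })
    (λ { (inj₁ _) → refl ; (inj₂ _) → refl })
    (λ { (zero , _) → refl ; (suc _ , _) → refl })

finite-Σ : {A : Set a} {B : A → Set b} →
           Finite A → (∀ x → Finite (B x)) → Finite (Σ A B)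
finite-Σ {B = B} (n , A↔n) fin =
  finite-↔ (↔-sym (Σ-↔ (↔-sym A↔n) (λ {i} → ↔-id (B (Inverse.from A↔n i)))))
           (finite-Σ-Fin n (λ i → fin (Inverse.from A↔n i)))

-- Stars and covering maps

module _ (C : UnivalentUpdownCategory ℓ) where
  open UnivalentUpdownCategory C

  Star : Ob → Set ℓ
  Star p = ∃ λ q → Hom p q × ∣ q ∣ ≡ ∣ p ∣ + 1

  star-≡ : ∀ {p q q′} {f : Hom p q} {g : Hom p q′}
           {r : ∣ q ∣ ≡ ∣ p ∣ + 1} {r′ : ∣ q′ ∣ ≡ ∣ p ∣ + 1}
           (eq : q ≡ q′) → subst (Hom p) eq f ≡ g →
           _≡_ {A = Star p} (q , f , r) (q′ , g , r′)
  star-≡ {q = q} {f = f} refl refl = cong (λ r → q , f , r) (uip _ _)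

  star-hom : ∀ {p q q′} {f : Hom p q} {g : Hom p q′}
             {r : ∣ q ∣ ≡ ∣ p ∣ + 1} {r′ : ∣ q′ ∣ ≡ ∣ p ∣ + 1} →
             _≡_ {A = Star p} (q , f , r) (q′ , g , r′) →
             (eq : q ≡ q′) → subst (Hom p) eq f ≡ g
  star-hom refl refl = refl

  star-finite : ∀ p → Finite (Star p)
  star-finite p = finite-↔
    (mk↔ₛ′ (λ (q , f , r) → (q , r) , f) (λ ((q , r) , f) → q , f , r)
           (λ _ → refl) (λ _ → refl))
    (finite-Σ (rank-finite (∣ p ∣ + 1)) (λ (q , _) → hom-finite p q))

  subst₂-∘ : ∀ {p q r p′ q′ r′} (i : p ≡ p′) (j : q ≡ q′) (k : r ≡ r′)
             (f : Hom q r) (g : Hom p q) →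
             subst₂ Hom i k (f ∘ g) ≡ subst₂ Hom j k f ∘ subst₂ Hom i j g
  subst₂-∘ refl refl refl f g = refl

  subst₂-id : ∀ {p p′} (i : p ≡ p′) → subst₂ Hom i i id ≡ id
  subst₂-id refl = refl

module _ (D E : UnivalentUpdownCategory ℓ) where
  private
    module D = UnivalentUpdownCategory D
    module E = UnivalentUpdownCategory E

  RankPreserving : Functor D.category E.category → Set ℓ
  RankPreserving F = ∀ p → E.∣ Functor.F₀ F p ∣ ≡ D.∣ p ∣

  module _ (F : Functor D.category E.category) (rp : RankPreserving F) where
    open Functor F

    raise : ∀ {p q} → D.∣ q ∣ ≡ D.∣ p ∣ + 1 → E.∣ F₀ q ∣ ≡ E.∣ F₀ p ∣ + 1
    raise {p} {q} r = trans (rp q) (trans r (cong (_+ 1) (sym (rp p))))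

    lower : ∀ {p q} → E.∣ F₀ q ∣ ≡ E.∣ F₀ p ∣ + 1 → D.∣ q ∣ ≡ D.∣ p ∣ + 1
    lower {p} {q} r = trans (sym (rp q)) (trans r (cong (_+ 1) (rp p)))

    star-map : ∀ p → Star D p → Star E (F₀ p)
    star-map p (q , f , r) = F₀ q , F₁ f , raise r

    0̂-preserved : F₀ D.0̂ ≡ E.0̂
    0̂-preserved = E.0̂-unique _ (trans (rp D.0̂) D.∣0̂∣≡0)

    -- A star collects the edges to all targets, so no fibre over a chosen `F₀ q` is involved.
    -- Surjectivity is held as a function `lift`, to be iterated along chains and paths.
    record StarBijective : Set ℓ where
      field
        injective : ∀ p {s t} → star-map p s ≡ star-map p t → s ≡ t
        lift      : ∀ p → Star E (F₀ p) → Star D p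
        lift-over : ∀ p s → star-map p (lift p s) ≡ s

    module _ (sb : StarBijective) where
      open StarBijective sb

      -- Edges are lifted one after another. The first lift ends over the next object only up to
      -- `lift-over`, hence the transport of the tail `c`.
      lift-chain : ∀ p {k q} → Chain E.category E.rank k (F₀ p) q →
                   ∃ λ p′ → F₀ p′ ≡ q
      lift-chain p []            = p , refl
      lift-chain p ((f , r) ∷ c) =
        lift-chain (proj₁ s)
          (subst (λ x → Chain E.category E.rank _ x _)
                 (sym (cong proj₁ (lift-over p (_ , f , r)))) c)
        where s = lift p (_ , f , r)

      -- By (A4) a morphism from `0̂` to `q` splits into edges, and this chain lifts from `D.0̂`.
      -- Rank 0 is separate because `factor` asks for length at least 1; there `q` is `0̂`.
      preimage : ∀ n q → E.∣ q ∣ ≡ n → ∃ λ p → F₀ p ≡ q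
      preimage zero    q eq = D.0̂ , trans 0̂-preserved (sym (E.0̂-unique q eq))
      preimage (suc n) q eq =
        lift-chain D.0̂
          (subst (λ x → Chain E.category E.rank _ x q) (sym 0̂-preserved)
                 (proj₁ (E.factor (suc n) (s≤s z≤n)
                                  (trans eq (cong (_+ suc n) (sym E.∣0̂∣≡0)))
                                  (E.0̂-hom q))))

      -- At `p` and `q`, `induced` is `star-map p` restricted to the edges whose image ends at
      -- `F₀ q`, so bijectivity on the star passes to each such fibre.
      starBijective⇒covering : CoveringMap D E
      starBijective⇒covering = record
        { morphism = record
          { functor           = F
          ; rank-preserving   = rp
          ; induced-injective = induced-inj
          }
        ; surjective        = λ q → let p , eq = preimage _ q refl in
                                    p , λ { refl → eq }
        ; induced-bijective = λ p q r → induced-inj p q r , induced-surj p q r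
        }
        where
        induced-inj : ∀ p q → D.∣ q ∣ ≡ D.∣ p ∣ + 1 →
                      Injective _≡_ _≡_ (induced D E F p q)
        induced-inj p q r {(q₁ , eq₁) , f₁} {(q₂ , eq₂) , f₂} eq =
          -- Both edges have the same image: the edge to `F₀ q` carrying the common value of
          -- `induced`.
          fibre-≡ (injective p {q₁ , f₁ , r₁} {q₂ , f₂ , r₂}
            (trans (star-≡ E {r′ = raise r} eq₁ refl)
                   (sym (star-≡ E eq₂ (sym eq)))))
          where
          r₁ = lower (trans (cong E.∣_∣ eq₁) (raise r))
          r₂ = lower (trans (cong E.∣_∣ eq₂) (raise r))

          fibre-≡ : ∀ {q₁ q₂ f₁ f₂ r₁ r₂ eq₁ eq₂} →
                    _≡_ {A = Star D p} (q₁ , f₁ , r₁) (q₂ , f₂ , r₂) →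
                    _≡_ {A = FibreHom D E F p q} ((q₁ , eq₁) , f₁) ((q₂ , eq₂) , f₂)
          fibre-≡ {q₁} {f₁ = f₁} refl = cong (λ e → (q₁ , e) , f₁) (uip _ _)

        induced-surj : ∀ p q → D.∣ q ∣ ≡ D.∣ p ∣ + 1 →
                       Surjective _≡_ _≡_ (induced D E F p q)
        induced-surj p q r g =
          ((proj₁ t , cong proj₁ over) , proj₁ (proj₂ t)) ,
          λ { refl → star-hom E over (cong proj₁ over) }
          where
          s    = F₀ q , g , raise r
          t    = lift p s
          over = lift-over p s

module _ {D E : UnivalentUpdownCategory ℓ} (φ : CoveringMap D E) where
  private
    module D = UnivalentUpdownCategory D
    module E = UnivalentUpdownCategory E
  open CoveringMap φ

  -- The covering condition only concerns edges ending at some `F₀ q`. Surjectivity on objects puts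
  -- an arbitrary target in this form, after which the edge lifts, possibly to a target `q′` other
  -- than `q`.
  covering⇒starBijective : StarBijective D E functor rank-preserving
  covering⇒starBijective = record
    { injective = λ p {s} {t} → inj p {s} {t}
    ; lift      = λ p s → proj₁ (lifting p s)
    ; lift-over = λ p s → proj₂ (lifting p s)
    }
    where
    inj : ∀ p {s t} → star-map D E functor rank-preserving p s
                    ≡ star-map D E functor rank-preserving p t → s ≡ t
    inj p {q₁ , f₁ , r₁} {q₂ , f₂ , r₂} eq =
      fibre-≡ (induced-injective p q₂ r₂ {(q₁ , cong proj₁ eq) , f₁} {(q₂ , refl) , f₂}
                 (star-hom E eq (cong proj₁ eq)))
      where
      fibre-≡ : ∀ {e₁ e₂} →
                _≡_ {A = FibreHom D E functor p q₂} ((q₁ , e₁) , f₁) ((q₂ , e₂) , f₂) →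
                _≡_ {A = Star D p} (q₁ , f₁ , r₁) (q₂ , f₂ , r₂)
      fibre-≡ refl = star-≡ D refl refl

    lifting : ∀ p s → ∃ λ t → star-map D E functor rank-preserving p t ≡ s
    lifting p (x , f , r) with surjective x
    ... | q , over with over refl
    ... | refl with proj₂ (induced-bijective p q (lower D E functor rank-preserving r)) f
    ... | ((q′ , eq) , f′) , hit =
      (q′ , f′ , lower D E functor rank-preserving (trans (cong E.∣_∣ eq) r)) ,
      star-≡ E eq (hit refl)

-- Cancelling a star-bijective functor.

module _ (B D E : UnivalentUpdownCategory ℓ) where
  private
    module B = UnivalentUpdownCategory B
    module D = UnivalentUpdownCategory D
    module E = UnivalentUpdownCategory E

  module _
    (π : Functor B.category E.category) (π-rank : RankPreserving B E π)
    (φ : Functor D.category E.category) (φ-rank : RankPreserving D E φ)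
    (ψ : Functor B.category D.category) (ψ-rank : RankPreserving B D ψ)
    (π≡φψ : π ≡F φ ∘F ψ)
    (π-bij : StarBijective B E π π-rank) (φ-bij : StarBijective D E φ φ-rank)
    where
    private
      module π = StarBijective π-bij
      module φ = StarBijective φ-bij
      over : ∀ p → Functor.F₀ π p ≡ Functor.F₀ φ (Functor.F₀ ψ p)
      over = proj₁ π≡φψ

    subst-star : ∀ {p p′ q q′} (i : p ≡ p′) (j : q ≡ q′)
                 {f : E.Hom p q} {g : E.Hom p′ q′}
                 {r : E.∣ q ∣ ≡ E.∣ p ∣ + 1} {r′ : E.∣ q′ ∣ ≡ E.∣ p′ ∣ + 1} →
                 subst₂ E.Hom i j f ≡ g →
                 subst (Star E) i (q , f , r) ≡ (q′ , g , r′)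
    subst-star refl refl refl = star-≡ E refl refl

    star-triangle : ∀ p s → subst (Star E) (over p) (star-map B E π π-rank p s)
                          ≡ star-map D E φ φ-rank _ (star-map B D ψ ψ-rank p s)
    star-triangle p (q , f , r) = subst-star (over p) (over q) (proj₂ π≡φψ f)

    subst-injective : ∀ {p p′} (i : p ≡ p′) {s t : Star E p} →
                      subst (Star E) i s ≡ subst (Star E) i t → s ≡ t
    subst-injective refl eq = eq

    subst-sym : ∀ {p p′} (i : p ≡ p′) (s : Star E p′) →
                subst (Star E) i (subst (Star E) (sym i) s) ≡ s
    subst-sym refl s = refl

    -- On stars π is φ after ψ, by `star-triangle`. Hence ψ is injective because π is. To lift an
    -- edge along ψ, push it down by φ and lift it along π; injectivity of φ shows that the result
    -- lies over the given edge.
    starBijective-cancel : StarBijective B D ψ ψ-rank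
    starBijective-cancel = record
      { injective = λ p {s} {t} eq → π.injective p (subst-injective (over p)
          (trans (star-triangle p s)
            (trans (cong (star-map D E φ φ-rank _) eq) (sym (star-triangle p t)))))
      ; lift      = up
      ; lift-over = λ p s → φ.injective _
          (trans (sym (star-triangle p (up p s)))
            (trans (cong (subst (Star E) (over p)) (π.lift-over p _))
                   (subst-sym (over p) _)))
      }
      where
      up : ∀ p → Star D (Functor.F₀ ψ p) → Star B p
      up p s = π.lift p (subst (Star E) (sym (over p)) (star-map D E φ φ-rank _ s))

-- The tree of paths

module UniversalCover (C : UnivalentUpdownCategory ℓ) where
  open UnivalentUpdownCategory C

  infixl 5 _▸_

  -- Paths grow at the end, so dropping the last edge gives the parent in the tree.
  -- Induction-recursion with `end` makes consecutive edges composable by construction.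
  data Path : Set ℓ
  end : Path → Ob

  data Path where
    []  : Path
    _▸_ : (P : Path) → Star C (end P) → Path

  end []      = 0̂
  end (P ▸ s) = proj₁ s

  data _⊑_ (P : Path) : Path → Set ℓ where
    here : P ⊑ P
    step : ∀ {Q s} → P ⊑ Q → P ⊑ (Q ▸ s)

  -- This is the length of the path, since `0̂` has rank 0 and each edge adds 1. Read off the
  -- endpoint, it makes `endpoint` rank-preserving by `refl`.
  ∥_∥ : Path → ℕ
  ∥ P ∥ = ∣ end P ∣

  ▸-rank : ∀ P (s : Star C (end P)) → ∥ P ▸ s ∥ ≡ suc ∥ P ∥
  ▸-rank P (_ , _ , r) = trans r (+-comm ∥ P ∥ 1)

  ⊑-rank : ∀ {P Q} → P ⊑ Q → ∥ P ∥ ≤ ∥ Q ∥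
  ⊑-rank here               = ≤-refl
  ⊑-rank (step {Q} {s} P⊑Q) =
    ≤-trans (⊑-rank P⊑Q) (<⇒≤ (≤-reflexive (sym (▸-rank Q s))))

  step-rank : ∀ {P Q} s → P ⊑ Q → ∥ P ∥ < ∥ Q ▸ s ∥
  step-rank {Q = Q} s P⊑Q =
    ≤-trans (s≤s (⊑-rank P⊑Q)) (≤-reflexive (sym (▸-rank Q s)))

  -- A `step` strictly raises the rank, so it cannot coexist with `here`. Thus the tree is a thin
  -- category, and equations between its parallel morphisms are immediate.
  ⊑-irrelevant : ∀ {P Q} → Irrelevant (P ⊑ Q)
  ⊑-irrelevant here here = refl
  ⊑-irrelevant here (step {s = s} f) = ⊥-elim (<-irrefl refl (step-rank s f))
  ⊑-irrelevant (step {s = s} f) here = ⊥-elim (<-irrefl refl (step-rank s f))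
  ⊑-irrelevant (step f) (step g) = cong step (⊑-irrelevant f g)

  ⊑-trans : ∀ {P Q R} → Q ⊑ R → P ⊑ Q → P ⊑ R
  ⊑-trans here     g = g
  ⊑-trans (step f) g = step (⊑-trans f g)

  tree : Category ℓ ℓ
  tree = record
    { Ob        = Path
    ; Hom       = _⊑_
    ; id        = here
    ; _∘_       = ⊑-trans
    ; identityˡ = λ _ → refl
    ; identityʳ = λ _ → ⊑-irrelevant _ _
    ; assoc     = λ _ _ _ → ⊑-irrelevant _ _
    }

  extension : ∀ {P Q} → P ⊑ Q → Hom (end P) (end Q)
  extension here                   = id
  extension (step {s = _ , e , _} f) = e ∘ extension f

  extension-∘ : ∀ {P Q R} (f : Q ⊑ R) (g : P ⊑ Q) →
                extension (⊑-trans f g) ≡ extension f ∘ extension g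
  extension-∘ here     g = sym (identityˡ _)
  extension-∘ (step {s = _ , e , _} f) g =
    trans (cong (e ∘_) (extension-∘ f g)) (sym (assoc _ _ _))

  endpoint : Functor tree category
  endpoint = record
    { F₀           = end
    ; F₁           = extension
    ; identity     = refl
    ; homomorphism = extension-∘
    }

  -- Only `[]` has rank 0, and a path of rank `suc n` is a path of rank `n` followed by an edge from
  -- a finite star.
  paths-finite : ∀ n → Finite (∃ λ P → ∥ P ∥ ≡ n)
  paths-finite zero = 1 , mk↔ₛ′ (λ _ → zero) (λ _ → [] , ∣0̂∣≡0)
    (λ { zero → refl })
    (λ { ([] , _)    → cong ([] ,_) (uip _ _)
       ; (P ▸ s , r) → ⊥-elim (1+n≢0 (trans (sym (▸-rank P s)) r)) })
  paths-finite (suc n) = finite-↔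
    (mk↔ₛ′ to from to∘from from∘to)
    (finite-Σ (paths-finite n) (λ (P , _) → star-finite C (end P)))
    where
    to : (∃ λ P → ∥ P ∥ ≡ suc n) → Σ (∃ λ P → ∥ P ∥ ≡ n) (λ (P , _) → Star C (end P))
    to ([] , r) with () ← trans (sym ∣0̂∣≡0) r
    to (P ▸ s , r) = (P , suc-injective (trans (sym (▸-rank P s)) r)) , s

    from : Σ (∃ λ P → ∥ P ∥ ≡ n) (λ (P , _) → Star C (end P)) → ∃ λ P → ∥ P ∥ ≡ suc n
    from ((P , r) , s) = P ▸ s , trans (▸-rank P s) (cong suc r)

    to∘from : ∀ x → to (from x) ≡ x
    to∘from ((P , r) , s) = cong (λ r → (P , r) , s) (uip _ _)

    from∘to : ∀ x → from (to x) ≡ x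
    from∘to ([] , r) with () ← trans (sym ∣0̂∣≡0) r
    from∘to (P ▸ s , r) = cong (P ▸ s ,_) (uip _ _)

  _≟ₚ_ : DecidableEquality Path
  P ≟ₚ Q with ∥ Q ∥ ≟ ∥ P ∥
  ... | no  ≢  = no λ { refl → ≢ refl }
  ... | yes eq =
    map′ (cong proj₁) (λ { refl → cong (P ,_) (uip _ _) })
         (finite-≟ (paths-finite ∥ P ∥) (P , refl) (Q , eq))

  -- This serves the finiteness of hom-sets: a proposition is `Finite` once it is decided. If `P`
  -- and `Q` differ, a proof must end in `step`, so the last edge of `Q` is dropped.
  _⊑?_ : ∀ P Q → Dec (P ⊑ Q)
  P ⊑? Q with P ≟ₚ Q
  ... | yes refl = yes here
  P ⊑? []      | no ≢ = no λ { here → ≢ refl }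
  P ⊑? (Q ▸ s) | no ≢ = map′ step (λ { here → ⊥-elim (≢ refl) ; (step f) → f }) (P ⊑? Q)

  []-⊑ : ∀ P → [] ⊑ P
  []-⊑ []      = here
  []-⊑ (P ▸ s) = step ([]-⊑ P)

  -- Factorization into edges and the updown structure.

  tree-rank : Functor tree ℕ-category
  tree-rank = rank ∘F endpoint

  snoc : ∀ {k P Q s} → Chain tree tree-rank k P Q → Chain tree tree-rank (suc k) P (Q ▸ s)
  snoc {s = _ , _ , r} [] = (step here , r) ∷ []
  snoc (e ∷ c)            = e ∷ snoc c

  -- Recursion on `P ⊑ Q` peels off the last edge, while a `Chain` begins with its first; hence
  -- `snoc`. The rank equation forces `k` to be the number of steps, which excludes the mismatched
  -- cases.
  chain : ∀ {P Q} k → ∥ Q ∥ ≡ ∥ P ∥ + k → P ⊑ Q → Chain tree tree-rank k P Q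
  chain zero    r here     = []
  chain {P} (suc k) r here = ⊥-elim (<-irrefl r
    (≤-trans (s≤s (m≤m+n ∥ P ∥ k)) (≤-reflexive (sym (+-suc ∥ P ∥ k)))))
  chain {P} zero r (step {s = s} f) =
    ⊥-elim (<-irrefl (sym (trans r (+-identityʳ ∥ P ∥))) (step-rank s f))
  chain {P} (suc k) r (step {Q} {s} f) =
    snoc (chain k (suc-injective (trans (sym (▸-rank Q s)) (trans r (+-suc ∥ P ∥ k)))) f)

  cover : UnivalentUpdownCategory ℓ
  cover = record
    { updownCategory = record
      { category    = tree
      ; rank        = tree-rank
      ; rank-finite = paths-finite
      ; 0̂           = []
      ; ∣0̂∣≡0       = ∣0̂∣≡0
      ; 0̂-unique    = λ
        { []      _ → refl
        ; (P ▸ s) r → ⊥-elim (1+n≢0 (trans (sym (▸-rank P s)) r)) }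
      ; 0̂-hom       = []-⊑
      ; hom-finite  = λ P Q → finite-dec-prop ⊑-irrelevant (P ⊑? Q)
      ; hom-rank    = λ { here → inj₂ refl ; (step {s = s} f) → inj₁ (step-rank s f) }
      -- Every automorphism is the identity, hence its own inverse.
      ; aut-group   = λ P → (λ f → f) , record
        { isMonoid = record
          { isSemigroup = record
            { isMagma = record
              { isEquivalence = isEquivalence
              ; ∙-cong        = cong₂ ⊑-trans
              }
            ; assoc   = λ _ _ _ → ⊑-irrelevant _ _
            }
          ; identity    = (λ _ → ⊑-irrelevant _ _) , (λ _ → ⊑-irrelevant _ _)
          }
        ; inverse  = (λ _ → ⊑-irrelevant _ _) , (λ _ → ⊑-irrelevant _ _)
        ; ⁻¹-cong  = λ eq → eq
        }
      ; factor      = λ k _ r f → chain k r f , ⊑-irrelevant _ _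
      ; freeʳ       = λ _ _ _ _ → ⊑-irrelevant _ _
      ; freeˡ       = λ _ _ _ _ → ⊑-irrelevant _ _
      }
    ; aut-trivial = λ _ → ⊑-irrelevant _ _
    }

  -- The endpoint projection.

  endpoint-rank : RankPreserving cover C endpoint
  endpoint-rank _ = refl

  -- The edges out of `P` in the tree are the one-step extensions `P ▸ s`, one for each edge `s` out
  -- of `end P`, so `extend` is a two-sided inverse of `star-map`.
  endpoint-starBijective : StarBijective cover C endpoint endpoint-rank
  endpoint-starBijective = record
    { injective = λ P {s} {t} eq →
        trans (sym (extend-end P s)) (trans (cong (extend P) eq) (extend-end P t))
    ; lift      = extend
    ; lift-over = λ P s → star-≡ C refl (identityʳ _)
    }
    where
    extend : ∀ P → Star C (end P) → Star cover P
    extend P s = P ▸ s , step here , proj₂ (proj₂ s)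

    extend-end : ∀ P t → extend P (star-map cover C endpoint endpoint-rank P t) ≡ t
    -- `here` raises the rank by 0 and two or more steps by at least 2, so only a single `step here`
    -- survives.
    extend-end P (.P , here , r) =
      ⊥-elim (<-irrefl r (≤-reflexive (+-comm 1 ∥ P ∥)))
    extend-end P (.(P ▸ _) , step {s = _ , e , _} here , r) =
      cover-≡ (star-≡ C refl (identityʳ e))
      where
      cover-≡ : ∀ {s t r r′} → s ≡ t →
                _≡_ {A = Star cover P} (P ▸ s , step here , r) (P ▸ t , step here , r′)
      cover-≡ refl = star-≡ cover refl refl
    extend-end P (.((Q ▸ s) ▸ t) , step {s = t} (step {Q} {s} f) , r) =
      ⊥-elim (<-irrefl (sym (+-cancelʳ-≡ 1 _ _ (trans (sym (proj₂ (proj₂ t))) r)))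
                       (step-rank s f))

  projection : CoveringMap cover C
  projection = starBijective⇒covering cover C endpoint endpoint-rank endpoint-starBijective

  -- Lifting paths along a covering map.

  module Lift (C′ : UnivalentUpdownCategory ℓ) (φ : CoveringMap C′ C) where
    private
      module C′ = UnivalentUpdownCategory C′
      module φ = CoveringMap φ

    φ-star : ∀ p → Star C′ p → Star C (φ.F₀ p)
    φ-star = star-map C′ C φ.functor φ.rank-preserving

    φ-bij : StarBijective C′ C φ.functor φ.rank-preserving
    φ-bij = covering⇒starBijective φ

    open StarBijective φ-bij

    -- An edge out of `end P` can be lifted along φ only after transport to `φ.F₀ (end′ P)`. So the
    -- endpoint of the lifted path, its position over `end P` and the lifted edges are built by
    -- mutual recursion.
    end′  : Path → C′.Ob
    over  : ∀ P → end P ≡ φ.F₀ (end′ P)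
    edge′ : ∀ P → Star C (end P) → Star C′ (end′ P)

    end′ []      = C′.0̂
    end′ (P ▸ s) = proj₁ (edge′ P s)

    edge′ P s = lift (end′ P) (subst (Star C) (over P) s)

    edge′-over : ∀ P s → φ-star (end′ P) (edge′ P s) ≡ subst (Star C) (over P) s

    over []      = sym (0̂-preserved C′ C φ.functor φ.rank-preserving)
    over (P ▸ s) = trans (proj₁-subst (over P) s) (cong proj₁ (sym (edge′-over P s)))
      where
      proj₁-subst : ∀ {p p′} (i : p ≡ p′) (s : Star C p) →
                    proj₁ s ≡ proj₁ (subst (Star C) i s)
      proj₁-subst refl s = refl

    edge′-over P s = lift-over (end′ P) (subst (Star C) (over P) s)

    extension′ : ∀ {P Q} → P ⊑ Q → C′.Hom (end′ P) (end′ Q)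
    extension′ here               = C′.id
    extension′ (step {Q} {s} f) = proj₁ (proj₂ (edge′ Q s)) C′.∘ extension′ f

    extension′-∘ : ∀ {P Q R} (f : Q ⊑ R) (g : P ⊑ Q) →
                   extension′ (⊑-trans f g) ≡ extension′ f C′.∘ extension′ g
    extension′-∘ here     g = sym (C′.identityˡ _)
    extension′-∘ (step f) g =
      trans (cong (_ C′.∘_) (extension′-∘ f g)) (sym (C′.assoc _ _ _))

    endpoint′ : Functor tree C′.category
    endpoint′ = record
      { F₀           = end′
      ; F₁           = extension′
      ; identity     = refl
      ; homomorphism = extension′-∘
      }

    endpoint′-rank : RankPreserving cover C′ endpoint′
    endpoint′-rank P =
      trans (sym (φ.rank-preserving (end′ P))) (cong ∣_∣ (sym (over P)))

    subst-star-hom : ∀ {p p′} (i : p ≡ p′) (s : Star C p) {t : Star C p′} →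
                     t ≡ subst (Star C) i s → (j : proj₁ s ≡ proj₁ t) →
                     subst₂ Hom i j (proj₁ (proj₂ s)) ≡ proj₁ (proj₂ t)
    subst-star-hom refl s refl refl = refl

    -- Transport distributes over composition, with `over Q` in the middle; the last edge is handled
    -- by `edge′-over` and the rest by induction.
    extension-over : ∀ {P Q} (f : P ⊑ Q) →
                     subst₂ Hom (over P) (over Q) (extension f) ≡ φ.F₁ (extension′ f)
    extension-over {P} here = trans (subst₂-id C (over P)) (sym φ.identity)
    extension-over {P} (step {Q} {s} f) =
      trans (subst₂-∘ C (over P) (over Q) (over (Q ▸ s)) _ _)
        (trans (cong₂ _∘_ (subst-star-hom (over Q) s (edge′-over Q s) (over (Q ▸ s)))
                          (extension-over f))
               (sym (φ.homomorphism _ _)))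

    endpoint-factors : endpoint ≡F φ.functor ∘F endpoint′
    endpoint-factors = over , extension-over

    -- Both `endpoint` and φ are bijective on stars, so `endpoint′` is too by cancellation.
    lifted : CoveringMap cover C′
    lifted = starBijective⇒covering cover C′ endpoint′ endpoint′-rank
      (starBijective-cancel cover C′ C
        endpoint endpoint-rank φ.functor φ.rank-preserving endpoint′ endpoint′-rank
        endpoint-factors endpoint-starBijective φ-bij)

theorem4p3 : ∀ {ℓ : Level} (C : UnivalentUpdownCategory ℓ) →
    ∃ λ (C̃ : UnivalentUpdownCategory ℓ) →
    ∃ λ (π : CoveringMap C̃ C) → IsUniversal π
theorem4p3 C = cover , projection , λ C′ φ → Lift.lifted C′ φ , Lift.endpoint-factors C′ φ
  where open UniversalCover C
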